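{- Let $q\ge 2$, $n\ge 1$, $h\in F(n,q)$ and $k=\kappa^{\min}(h)$. Then $$\mathcal{L}^*(h)=\mathcal{L}(h\,|\,n+k)=\Omega(h)+k .$$
   Context: Let $q\ge 2$, $A=\{0,1,\dots,q-1\}$, $[n]=\{1,\dots,n\}$, and let $F(n,q)$ be the set of all maps $A^n\to A^n$. For $f\in F(m,q)$ and $i\in[m]$, $f_i$ is the $i$-th coordinate function and $f^i(x)=(x_1,\dots,x_{i-1},f_i(x),x_{i+1},\dots,x_m)$; for a word $w=(w_1,\dots,w_t)$ over $[m]$, $f^w=f^{w_t}\circ\cdots\circ f^{w_1}$. $\Pi([m])$ is the set of permutations of $[m]$ written as words $(w_1,\dots,w_m)$. $\mathrm{pr}_{[n]}:A^m\to A^n$ is the projection onto the first $n$ coordinates. For $m\ge n$, $(f,w)$ with $f\in F(m,q)$, $w\in\Pi([m])$ sequentializes $h\in F(n,q)$ if $\mathrm{pr}_{[n]}\circ f^w=h\circ\mathrm{pr}_{[n]}$. $\kappa^{\min}(h)$ is the smallest $k\ge 0$ such that there exist $f\in F(n+k,q)$ and $w\in\Pi([n+k])$ with $(f,w)$ sequentializing $h$. A coordinate function $h_i$ is trivial if $h_i(x)=x_i$ for all $x$; $\Omega(h)$ is the number of $i\in[n]$ such that $h_i$ is not trivial. $F^*(m,q)$ is the set of $g\in F(m,q)$ that update at most one coordinate, i.e. there is $i\in[m]$ with $g_j(x)=x_j$ for all $j\ne i$ and all $x\in A^m$. For $m\ge n$, $\mathcal{L}(h\,|\,m)$ is the smallest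 $t\ge 0$ such that there exist $g^{(1)},\dots,g^{(t)}\in F^*(m,q)$ with $\mathrm{pr}_{[n]}\circ g^{(t)}\circ\cdots\circ g^{(1)}=h\circ\mathrm{pr}_{[n]}$, and $\mathcal{L}^*(h)=\min\{\mathcal{L}(h\,|\,m): m\ge n\}$. -}

module Defs where

open import Data.Fin.Base using (Fin)
open import Data.Fin.Properties using (all?; _≟_)
open import Data.List.Base as List using (List)
open import Data.List.Relation.Binary.Permutation.Propositional using (_↭_)
open import Data.Nat.Base using (ℕ; zero; suc; _+_; _≤_)
open import Data.Nat.Properties using (m≤m+n)
open import Data.Product.Base using (Σ; _×_)
open import Data.Vec.Base using (Vec; []; _∷_; lookup; _[_]≔_; truncate; allFin; count)
open import Data.Vec.Relation.Unary.All using (All)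
open import Level using (Level)
open import Relation.Binary.PropositionalEquality using (_≡_; _≢_)
open import Relation.Nullary using (Dec)
open import Relation.Nullary.Decidable using (map′; ¬?)
open import Relation.Unary using (Pred; Decidable)

private
  variable
    ℓ     : Level
    q n m : ℕ

-- The alphabet {0,…,q-1} is Fin q; coordinates are numbered from 0.
-- States are vectors rather than functions Fin n → Fin q, so that equality of
-- states is _≡_ without function extensionality; equality of maps is pointwise.
F : ℕ → ℕ → Set
F n q = Vec (Fin q) n → Vec (Fin q) n

pr : n ≤ m → Vec (Fin q) m → Vec (Fin q) n
pr = truncate

update : F m q → Fin m → F m q
update f i x = x [ i ]≔ lookup (f x) i

-- The first letter of the word is applied first.
updateWord : F m q → List (Fin m) → F m q
updateWord f w x = List.foldl (λ y i → update f i y) x w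

Π : (m : ℕ) → List (Fin m) → Set
Π m w = w ↭ List.allFin m

Sequentializes : n ≤ m → F m q → List (Fin m) → F n q → Set
Sequentializes n≤m f w h = ∀ x → pr n≤m (updateWord f w x) ≡ h (pr n≤m x)

IsLeast : Pred ℕ ℓ → Pred ℕ ℓ
IsLeast P k = P k × (∀ j → P j → k ≤ j)

-- The minima below are given by their graphs: κmin≡ h k reads "κmin(h) = k".
κmin≡ : F n q → ℕ → Set
κmin≡ {n} {q} h = IsLeast λ k →
  Σ (F (n + k) q) λ f → Σ (List (Fin (n + k))) λ w →
    Π (n + k) w × Sequentializes (m≤m+n n k) f w h

Trivial : F n q → Fin n → Set
Trivial h i = ∀ x → lookup (h x) i ≡ lookup x i

allVec? : {P : Pred (Vec (Fin q) n) ℓ} → Decidable P → Dec (∀ x → P x)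
allVec? {n = zero}  P? = map′ (λ { p [] → p }) (λ p → p []) (P? [])
allVec? {n = suc n} P? =
  map′ (λ { p (a ∷ x) → p a x }) (λ p a x → p (a ∷ x))
       (all? λ a → allVec? λ x → P? (a ∷ x))

trivial? : (h : F n q) → Decidable (Trivial h)
trivial? h i = allVec? λ x → lookup (h x) i ≟ lookup x i

Ω : F n q → ℕ
Ω {n} h = count (λ i → ¬? (trivial? h i)) (allFin n)

F* : Pred (F m q) _
F* {m} g = Σ (Fin m) λ i → ∀ j → j ≢ i → ∀ x → lookup (g x) j ≡ lookup x j

-- run (g₁ ∷ … ∷ gₜ ∷ []) = gₜ ∘ … ∘ g₁
run : ∀ {t} → Vec (F m q) t → F m q
run []       x = x
run (g ∷ gs) x = run gs (g x)

-- 𝓛≡ h n≤m t reads "𝓛(h | m) = t", and 𝓛*≡ h t reads "𝓛*(h) = t".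
𝓛≡ : F n q → n ≤ m → ℕ → Set
𝓛≡ {n} {q} {m} h n≤m = IsLeast λ t →
  Σ (Vec (F m q) t) λ gs →
    All F* gs × (∀ x → pr n≤m (run gs x) ≡ h (pr n≤m x))

𝓛*≡ : F n q → ℕ → Set
𝓛*≡ {n} h = IsLeast λ t → Σ ℕ λ m → Σ (n ≤ m) λ n≤m → 𝓛≡ h n≤m t

{-# OPTIONS --safe #-}

-- Upper bound: in a sequentialization every coordinate is written exactly once, so the
-- update of a trivial coordinate rewrites the value already there and can be dropped.
--
-- Lower bound: turn a program of length t into a single-assignment one. The last write to
-- each nontrivial coordinate i is stored in location i, each of the other t - Ω(h) writes
-- in a fresh location of its own, and a table of current locations recovers the registers of
-- the original program. Every location is then written once, so the new program is f^w for
-- a map f and a permutation w, whence κmin(h) ≤ t - Ω(h).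
module Submission where

open import Data.Bool.Base using (true; false)
open import Data.Empty using (⊥)
open import Data.Fin.Base using (Fin; zero; suc; inject≤; _↑ˡ_; _↑ʳ_; splitAt)
open import Data.Fin.Properties
  using (_≟_; inject≤-injective; ↑ˡ-injective; ↑ʳ-injective; splitAt-↑ˡ; splitAt-↑ʳ; splitAt⁻¹-↑ˡ)
open import Data.List.Base as List using (List; []; _∷_; _++_; map; length; filter)
open import Data.List.Properties
  using (map-∘; map-++; map-tabulate; length-map; length-tabulate; length-++;
         filter-++; filter-all; filter-accept; filter-reject; ++-assoc; partition-defn)
import Data.List.Membership.DecPropositional as DecMembership
open import Data.List.Membership.Propositional using (_∈_; _∉_)
open import Data.List.Membership.Propositional.Properties
  using (∈-∃++; ∈-map⁺; ∈-map⁻; ∈-++⁻; ∈-filter⁺; ∈-filter⁻; ∈-tabulate⁻; ∈-allFin)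
open import Data.List.Relation.Binary.Permutation.Propositional
  using (_↭_; ↭-refl; ↭-sym; ↭-trans; ↭-prep; ↭⇒↭ₛ; ↭ₛ⇒↭; module PermutationReasoning)
import Data.List.Relation.Binary.Permutation.Propositional.Properties as ↭
import Data.List.Relation.Binary.Permutation.Setoid.Properties as ↭ₛ
open import Data.List.Relation.Binary.Subset.Propositional using (_⊆_)
open import Data.List.Relation.Unary.All as All using (All; []; _∷_)
import Data.List.Relation.Unary.All.Properties as All
open import Data.List.Relation.Unary.AllPairs using ([]; _∷_)
open import Data.List.Relation.Unary.Any using (here; there)
open import Data.List.Relation.Unary.Unique.Propositional using (Unique)
import Data.List.Relation.Unary.Unique.Propositional.Properties as Unique
open import Data.Maybe.Base using (Maybe; just; nothing; maybe′)
open import Data.Maybe.Properties using (just-injective)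
open import Data.Nat.Base using (ℕ; zero; suc; _+_; _∸_; _≤_; z≤n; s≤s)
open import Data.Nat.Properties
  using (m≤m+n; +-identityʳ; m+[n∸m]≡n; 1+n≰n; +-monoʳ-≤; suc-injective; +-suc;
         module ≤-Reasoning)
open import Data.Product.Base using (Σ; ∃; _×_; _,_; proj₁; proj₂)
open import Data.Sum.Base using (_⊎_; inj₁; inj₂; [_,_]′)
open import Data.Unit.Base using (⊤; tt)
open import Data.Vec.Base as Vec
  using (Vec; []; _∷_; lookup; _[_]≔_; padRight; fromList)
open import Data.Vec.Properties
  using (lookup∘update; lookup∘update′; []≔-lookup; lookup-map; lookup-truncate; lookup∘tabulate;
         tabulate∘lookup; tabulate-cong; truncate-padRight; lookup-replicate)
import Data.Vec.Relation.Unary.All as VAll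
open import Function.Base using (_∘_; id)
open import Relation.Binary.PropositionalEquality
  using (_≡_; _≢_; refl; sym; trans; cong; cong₂; subst; subst₂; setoid; module ≡-Reasoning)
open import Relation.Nullary using (Dec; yes; no; does; ¬_; contradiction)
open import Relation.Nullary.Decidable using (¬?; _×-dec_)
open import Relation.Unary using (Pred; Decidable)

open import Defs

private
  variable
    A E : Set
    q n m l t : ℕ

-- Lists and vectors

lookup-ext : {xs ys : Vec A n} → (∀ i → lookup xs i ≡ lookup ys i) → xs ≡ ys
lookup-ext {xs = xs} {ys} eq = begin
  xs                        ≡⟨ tabulate∘lookup xs ⟨
  Vec.tabulate (lookup xs)  ≡⟨ tabulate-cong eq ⟩
  Vec.tabulate (lookup ys)  ≡⟨ tabulate∘lookup ys ⟩
  ys                        ∎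
  where open ≡-Reasoning

-- Needed for the initial table: the padding consists of `nothing`, so an actual location can only
-- sit in one of the first n entries.
lookup-padRight-just : (n≤m : n ≤ m) (xs : Vec (Maybe A) n) (r : Fin m) {a : A} →
  lookup (padRight n≤m nothing xs) r ≡ just a →
  ∃ λ i → r ≡ inject≤ i n≤m × lookup xs i ≡ just a
lookup-padRight-just z≤n [] r eq with trans (sym (lookup-replicate r nothing)) eq
... | ()
lookup-padRight-just (s≤s n≤m) (x ∷ xs) zero    eq = zero , refl , eq
lookup-padRight-just (s≤s n≤m) (x ∷ xs) (suc r) eq
  with lookup-padRight-just n≤m xs r eq
... | i , refl , eq′ = suc i , refl , eq′

map-padRight : {B : Set} (f : A → B) (n≤m : n ≤ m) (a : A) (xs : Vec A n) →
  Vec.map f (padRight n≤m a xs) ≡ padRight n≤m (f a) (Vec.map f xs)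
map-padRight f (s≤s n≤m) a (x ∷ xs) = cong (f x ∷_) (map-padRight f n≤m a xs)
map-padRight {m = zero}  f z≤n a [] = refl
map-padRight {m = suc m} f z≤n a [] = cong (f a ∷_) (map-padRight {m = m} f z≤n a [])

pr-lookup-↑ˡ : ∀ n k (x : Vec A (n + k)) i →
  lookup (Vec.truncate (m≤m+n n k) x) i ≡ lookup x (i ↑ˡ k)
pr-lookup-↑ˡ (suc n) k (a ∷ x) zero    = refl
pr-lookup-↑ˡ (suc n) k (a ∷ x) (suc i) = pr-lookup-↑ˡ n k x i

↑ˡ≢↑ʳ : ∀ n k (i : Fin n) (j : Fin k) → i ↑ˡ k ≢ n ↑ʳ j
↑ˡ≢↑ʳ n k i j eq with trans (sym (splitAt-↑ˡ n i k)) (trans (cong (splitAt n) eq) (splitAt-↑ʳ n k j))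
... | ()

tabulate-+ : ∀ n {k} (f : Fin (n + k) → A) →
  List.tabulate f ≡ List.tabulate (f ∘ (_↑ˡ k)) ++ List.tabulate (f ∘ (n ↑ʳ_))
tabulate-+ zero    f = refl
tabulate-+ (suc n) f = cong (f zero ∷_) (tabulate-+ n (f ∘ suc))

allFin-+ : ∀ n k → List.allFin (n + k) ≡ map (_↑ˡ k) (List.allFin n) ++ List.tabulate (n ↑ʳ_)
allFin-+ n k = trans (tabulate-+ n id) (cong (_++ List.tabulate (n ↑ʳ_)) (sym (map-tabulate id (_↑ˡ k))))

Unique-resp-↭ : {xs ys : List A} → xs ↭ ys → Unique xs → Unique ys
Unique-resp-↭ xs↭ys = ↭ₛ.Unique-resp-↭ (setoid _) (↭⇒↭ₛ xs↭ys)

Π⇒Unique : {w : List (Fin m)} → Π m w → Unique w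
Π⇒Unique π = Unique-resp-↭ (↭-sym π) (Unique.allFin⁺ _)

-- Pigeonhole: cut one occurrence of the head out of `ys`. The head does not recur in the tail, so
-- the tail is still contained in what remains.
Unique-⊆⇒length≤ : {xs ys : List A} → Unique xs → xs ⊆ ys → length xs ≤ length ys
Unique-⊆⇒length≤ {xs = []}     _ _ = z≤n
Unique-⊆⇒length≤ {xs = x ∷ xs} (x∉xs ∷ xs!) x∷xs⊆ys with ∈-∃++ (x∷xs⊆ys (here refl))
... | ys₁ , ys₂ , refl = begin
  suc (length xs)            ≤⟨ s≤s (Unique-⊆⇒length≤ xs! xs⊆) ⟩
  suc (length (ys₁ ++ ys₂))  ≡⟨ ↭.↭-length (↭.shift x ys₁ ys₂) ⟨
  length (ys₁ ++ x ∷ ys₂)    ∎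
  where
  open ≤-Reasoning
  xs⊆ : xs ⊆ ys₁ ++ ys₂
  xs⊆ y∈xs with ↭.∈-resp-↭ (↭.shift x ys₁ ys₂) (x∷xs⊆ys (there y∈xs))
  ... | here refl  = contradiction refl (All.lookup x∉xs y∈xs)
  ... | there y∈ys = y∈ys

filter-∁-↭ : ∀ {p} {P : Pred A p} (P? : Decidable P) (xs : List A) →
  filter P? xs ++ filter (¬? ∘ P?) xs ↭ xs
filter-∁-↭ P? xs = ↭-sym (subst (λ (ys , zs) → xs ↭ ys ++ zs)
  (partition-defn P? xs) (↭ₛ⇒↭ (↭ₛ.partition-↭ (setoid _) P? xs)))

length-filter-map : ∀ {B : Set} {p} {P : Pred B p} {r} {R : Pred A r}
  (P? : Decidable P) (R? : Decidable R) (f : A → B) → (∀ a → does (P? (f a)) ≡ does (R? a)) →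
  ∀ xs → length (filter P? (map f xs)) ≡ length (filter R? xs)
length-filter-map P? R? f eq []       = refl
length-filter-map P? R? f eq (x ∷ xs) with does (P? (f x)) | does (R? x) | eq x
... | true  | _ | refl = cong suc (length-filter-map P? R? f eq xs)
... | false | _ | refl = length-filter-map P? R? f eq xs

length-filter-tabulate : ∀ {p} {P : Pred A p} (P? : Decidable P) (f : Fin n → A) →
  length (filter P? (List.tabulate f)) ≡ Vec.count P? (Vec.tabulate f)
length-filter-tabulate {n = zero}  P? f = refl
length-filter-tabulate {n = suc n} P? f with does (P? (f zero))
... | true  = cong suc (length-filter-tabulate P? (f ∘ suc))
... | false = length-filter-tabulate P? (f ∘ suc)

nontrivials : F n q → List (Fin n)
nontrivials {n} h = filter (¬? ∘ trivial? h) (List.allFin n)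

length-nontrivials : (h : F n q) → length (nontrivials h) ≡ Ω h
length-nontrivials h = length-filter-tabulate (¬? ∘ trivial? h) id

-- Programs as lists of assignments

-- Unlike a map in `F*`, an instruction keeps its target apart from the value it computes, so that
-- the value can be sent to another location.
Instr : ℕ → ℕ → Set
Instr m q = Fin m × (Vec (Fin q) m → Fin q)

exec : List (Instr m q) → F m q
exec []             x = x
exec ((r , e) ∷ is) x = exec is (x [ r ]≔ e x)

exec-++ : (is js : List (Instr m q)) (x : Vec (Fin q) m) → exec (is ++ js) x ≡ exec js (exec is x)
exec-++ []       js x = refl
exec-++ (_ ∷ is) js x = exec-++ is js _

exec-∉ : (is : List (Instr m q)) {r : Fin m} → r ∉ map proj₁ is →
  ∀ x → lookup (exec is x) r ≡ lookup x r
exec-∉ []             r∉ x = refl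
exec-∉ ((_ , e) ∷ is) r∉ x =
  trans (exec-∉ is (r∉ ∘ there) _) (lookup∘update′ (r∉ ∘ here) x (e x))

F*⇒assignment : (g : F m q) ((r , _) : F* g) → ∀ x → x [ r ]≔ lookup (g x) r ≡ g x
F*⇒assignment g (r , fix) x = lookup-ext eq
  where
  eq : ∀ j → lookup (x [ r ]≔ lookup (g x) r) j ≡ lookup (g x) j
  eq j with j ≟ r
  ... | yes refl = lookup∘update r x _
  ... | no j≢r   = trans (lookup∘update′ j≢r x _) (sym (fix j j≢r x))

instrs : {gs : Vec (F m q) t} → VAll.All F* gs → List (Instr m q)
instrs VAll.[] = []
instrs {gs = g ∷ _} ((r , _) VAll.∷ g*s) = (r , λ x → lookup (g x) r) ∷ instrs g*s

length-instrs : {gs : Vec (F m q) t} (g*s : VAll.All F* gs) → length (instrs g*s) ≡ t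
length-instrs VAll.[]          = refl
length-instrs (_ VAll.∷ g*s) = cong suc (length-instrs g*s)

exec-instrs : {gs : Vec (F m q) t} (g*s : VAll.All F* gs) → ∀ x → exec (instrs g*s) x ≡ run gs x
exec-instrs VAll.[] x = refl
exec-instrs {gs = g ∷ gs} (g* VAll.∷ g*s) x =
  trans (exec-instrs g*s _) (cong (run gs) (F*⇒assignment g g* x))

updateWord-cong : (f g : F m q) {w : List (Fin m)} →
  All (λ c → ∀ x → update f c x ≡ update g c x) w → ∀ x → updateWord f w x ≡ updateWord g w x
updateWord-cong f g         []         x = refl
updateWord-cong f g {c ∷ w} (eq ∷ eqs) x =
  trans (updateWord-cong f g eqs _) (cong (updateWord g w) (eq x))

-- As no target is repeated, a single map can hold the whole program: its coordinate c is the
-- expression of the only instruction that writes c.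
exec⇒updateWord : (is : List (Instr m q)) → Unique (map proj₁ is) →
  Σ (F m q) λ f → ∀ x → updateWord f (map proj₁ is) x ≡ exec is x
exec⇒updateWord []             []        = id , λ _ → refl
exec⇒updateWord {m} {q} ((c , e) ∷ is) (c∉ ∷ is!) with exec⇒updateWord is is!
... | f , f≗ = g , λ x →
  trans (updateWord-cong g f (All.map agree c∉) _)
        (trans (f≗ _) (cong (exec is) (cong (x [ c ]≔_) (lookup∘update c (f x) (e x)))))
  where
  g : F m q
  g x = f x [ c ]≔ e x
  -- Every later letter differs from c, so overriding coordinate c of `f` does not disturb its
  -- update.
  agree : ∀ {d} → c ≢ d → ∀ x → update g d x ≡ update f d x
  agree c≢d x = cong (x [ _ ]≔_) (lookup∘update′ (c≢d ∘ sym) (f x) (e x))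

-- Assigning a location to every write

module _ {m : ℕ} where
  open DecMembership (_≟_ {m}) public using (_∈?_)

register : (Fin m × E) × A → Fin m
register = proj₁ ∘ proj₁

data LastWrite {m} {E A : Set} (r : Fin m) (a : A) : List ((Fin m × E) × A) → Set where
  here  : ∀ {e ss} → r ∉ map register ss → LastWrite r a (((r , e) , a) ∷ ss)
  there : ∀ {s ss} → LastWrite r a ss → LastWrite r a (s ∷ ss)

-- `homes` prescribes a location for the last write to certain registers, and `fresh` is the pool
-- for all other writes. The permutation in `targets` makes every location used exactly once;
-- `sound` yields the safety of the simulation, and `last` tells where final values are found.
record Allocation (is : List (Fin m × E)) (homes : List (Fin m × A)) (fresh : List A) : Set where
  field
    steps   : List ((Fin m × E) × A)
    program : map proj₁ steps ≡ is
    targets : map proj₂ steps ↭ map proj₂ homes ++ fresh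
    sound   : All (λ s → proj₂ s ∈ fresh ⊎ (register s , proj₂ s) ∈ homes) steps
    last    : ∀ {r a} → (r , a) ∈ homes → LastWrite r a steps

-- Greedy along the program: a write goes to the home of its register if it is the last one there,
-- and to the next fresh location otherwise. The length equation makes both pools run out exactly
-- with the program.
allocate : (is : List (Fin m × E)) (homes : List (Fin m × A)) (fresh : List A) →
  Unique (map proj₁ homes) → map proj₁ homes ⊆ map proj₁ is →
  length homes + length fresh ≡ length is → Allocation is homes fresh
allocate [] [] [] _ _ _ = record
  { steps = [] ; program = refl ; targets = ↭-refl ; sound = [] ; last = λ () }
allocate {m = m} {A = A} ((r , e) ∷ is) homes fresh homes! homes⊆ len
  with r ∈? map proj₁ homes ×-dec ¬? (r ∈? map proj₁ is)
... | yes (r∈homes , r∉is) with ∈-map⁻ proj₁ r∈homes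
... | (_ , a) , p∈homes , refl with ∈-∃++ p∈homes
... | homes₁ , homes₂ , refl = record
  { steps   = ((r , e) , a) ∷ steps
  ; program = cong ((r , e) ∷_) program
  ; targets = ↭-trans (↭-prep a targets) (↭.++⁺ʳ fresh (↭-sym (↭.map⁺ proj₂ homes↭)))
  ; sound   = inj₂ p∈homes ∷ All.map [ inj₁ , (λ p∈ → inj₂ (↭.∈-resp-↭ (↭-sym homes↭) (there p∈))) ]′ sound
  ; last    = last′ ∘ ↭.∈-resp-↭ homes↭
  }
  where
  homes↭ : homes₁ ++ (r , a) ∷ homes₂ ↭ (r , a) ∷ homes₁ ++ homes₂
  homes↭ = ↭.shift (r , a) homes₁ homes₂

  rest! : Unique (r ∷ map proj₁ (homes₁ ++ homes₂))
  rest! = Unique-resp-↭ (↭.map⁺ proj₁ homes↭) homes!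

  rest⊆ : map proj₁ (homes₁ ++ homes₂) ⊆ map proj₁ is
  rest⊆ {j} j∈ with homes⊆ (↭.∈-resp-↭ (↭-sym (↭.map⁺ proj₁ homes↭)) (there j∈))
  ... | there j∈is = j∈is
  -- Home registers are distinct, so `r` does not occur again once its home is spent.
  ... | here refl  = contradiction j∈ (Unique.Unique[x∷xs]⇒x∉xs rest!)

  rest-len : length (homes₁ ++ homes₂) + length fresh ≡ length is
  rest-len = suc-injective (trans (cong (_+ length fresh) (sym (↭.↭-length homes↭))) len)

  tail! : Unique (map proj₁ (homes₁ ++ homes₂))
  tail! with _ ∷ u ← rest! = u

  open Allocation (allocate is (homes₁ ++ homes₂) fresh tail! rest⊆ rest-len)

  r∉steps : r ∉ map register steps
  r∉steps r∈ = r∉is (subst (r ∈_) (trans (map-∘ steps) (cong (map proj₁) program)) r∈)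

  last′ : ∀ {s b} → (s , b) ∈ (r , a) ∷ homes₁ ++ homes₂ → LastWrite s b (((r , e) , a) ∷ steps)
  last′ (here refl) = here r∉steps
  last′ (there p∈)  = there (last p∈)
allocate {m = m} ((r , e) ∷ is) homes fresh homes! homes⊆ len | no ¬last = go fresh len
  where
  -- If `r` has a home, it is written again later; otherwise the present write would be its last and
  -- belong to the other case.
  homes⊆is : map proj₁ homes ⊆ map proj₁ is
  homes⊆is {j} j∈ with homes⊆ j∈
  ... | there j∈is = j∈is
  ... | here refl with r ∈? map proj₁ is
  ...   | yes r∈is = r∈is
  ...   | no r∉is  = contradiction (j∈ , r∉is) ¬last

  homes≤is : length homes ≤ length is
  homes≤is = subst₂ _≤_ (length-map proj₁ homes) (length-map proj₁ is)
    (Unique-⊆⇒length≤ homes! homes⊆is)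

  go : ∀ fresh → length homes + length fresh ≡ suc (length is) →
    Allocation ((r , e) ∷ is) homes fresh
  -- With the pool empty, there would be more homes than remaining instructions, although each home
  -- register still awaits a write.
  go [] len = contradiction
    (subst (_≤ length is) (trans (sym (+-identityʳ _)) len) homes≤is) 1+n≰n
  go (a ∷ fresh) len = record
    { steps   = ((r , e) , a) ∷ steps
    ; program = cong ((r , e) ∷_) program
    ; targets = ↭-trans (↭-prep a targets) (↭-sym (↭.shift a (map proj₂ homes) fresh))
    ; sound   = inj₁ (here refl) ∷ All.map [ inj₁ ∘ there , inj₂ ]′ sound
    ; last    = there ∘ last
    }
    where
    open Allocation
      (allocate is homes fresh homes! homes⊆is (suc-injective (trans (sym (+-suc _ _)) len)))

-- Simulating a program on its allocated locations

-- An entry `nothing` reads as a fixed symbol, so the initial content of an auxiliary register takes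
-- up no location.
Table : ℕ → ℕ → Set
Table m l = Vec (Maybe (Fin l)) m

registers : Fin q → Table m l → Vec (Fin q) l → Vec (Fin q) m
registers a loc y = Vec.map (maybe′ (lookup y) a) loc

-- The table depends only on the position in the program and not on the state, so each expression is
-- precomposed with one fixed read-out of the registers.
translate : Fin q → Table m l → List (Instr m q × Fin l) → List (Instr l q)
translate a loc []                   = []
translate a loc (((r , e) , c) ∷ ss) =
  (c , e ∘ registers a loc) ∷ translate a (loc [ r ]≔ just c) ss

finalTable : Table m l → List (Instr m q × Fin l) → Table m l
finalTable loc []                   = loc
finalTable loc (((r , _) , c) ∷ ss) = finalTable (loc [ r ]≔ just c) ss

translate-targets : ∀ (a : Fin q) (loc : Table m l) ss →
  map proj₁ (translate a loc ss) ≡ map proj₂ ss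
translate-targets a loc []       = refl
translate-targets a loc (s ∷ ss) = cong (proj₂ s ∷_) (translate-targets a _ ss)

finalTable-∉ : ∀ (loc : Table m l) (ss : List (Instr m q × Fin l)) {r} → r ∉ map register ss →
  lookup (finalTable loc ss) r ≡ lookup loc r
finalTable-∉ loc []       r∉ = refl
finalTable-∉ loc (s ∷ ss) r∉ =
  trans (finalTable-∉ _ ss (r∉ ∘ there)) (lookup∘update′ (r∉ ∘ here) loc _)

finalTable-last : ∀ (loc : Table m l) {ss : List (Instr m q × Fin l)} {r c} → LastWrite r c ss →
  lookup (finalTable loc ss) r ≡ just c
finalTable-last loc {((r , _) , c) ∷ ss} (here r∉) =
  trans (finalTable-∉ _ ss r∉) (lookup∘update r loc (just c))
finalTable-last loc {_ ∷ _} (there lw) = finalTable-last _ lw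

-- A write must not destroy a value still held for another register. The register being written is
-- exempt, since its old value is replaced anyway.
Safe : Table m l → Instr m q × Fin l → Set
Safe loc s = ∀ r → r ≢ register s → lookup loc r ≢ just (proj₂ s)

registers-write : ∀ (a : Fin q) (loc : Table m l) r c v (y : Vec (Fin q) l) →
  (∀ j → j ≢ r → lookup loc j ≢ just c) →
  registers a (loc [ r ]≔ just c) (y [ c ]≔ v) ≡ registers a loc y [ r ]≔ v
registers-write {q} {l = l} a loc r c v y safe = lookup-ext eq
  where
  open ≡-Reasoning
  y′ = y [ c ]≔ v

  unaffected : ∀ o → o ≢ just c → maybe′ (lookup y′) a o ≡ maybe′ (lookup y) a o
  unaffected nothing  _  = refl
  unaffected (just d) d≢ = lookup∘update′ (d≢ ∘ cong just) y v

  eq : ∀ j → lookup (registers a (loc [ r ]≔ just c) y′) j ≡ lookup (registers a loc y [ r ]≔ v) j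
  eq j with j ≟ r
  ... | yes refl = begin
    lookup (registers a (loc [ r ]≔ just c) y′) r              ≡⟨ lookup-map r _ (loc [ r ]≔ just c) ⟩
    maybe′ (lookup y′) a (lookup (loc [ r ]≔ just c) r)        ≡⟨ cong (maybe′ (lookup y′) a) (lookup∘update r loc (just c)) ⟩
    lookup y′ c                                                ≡⟨ lookup∘update c y v ⟩
    v                                                          ≡⟨ lookup∘update r (registers a loc y) v ⟨
    lookup (registers a loc y [ r ]≔ v) r                      ∎
  ... | no j≢r = begin
    lookup (registers a (loc [ r ]≔ just c) y′) j              ≡⟨ lookup-map j _ (loc [ r ]≔ just c) ⟩
    maybe′ (lookup y′) a (lookup (loc [ r ]≔ just c) j)        ≡⟨ cong (maybe′ (lookup y′) a) (lookup∘update′ j≢r loc (just c)) ⟩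
    maybe′ (lookup y′) a (lookup loc j)                        ≡⟨ unaffected (lookup loc j) (safe j j≢r) ⟩
    maybe′ (lookup y) a (lookup loc j)                         ≡⟨ lookup-map j _ loc ⟨
    lookup (registers a loc y) j                               ≡⟨ lookup∘update′ j≢r (registers a loc y) v ⟨
    lookup (registers a loc y [ r ]≔ v) j                      ∎

-- Safety against the initial table is enough: each step adds only its own target to the table, and
-- by uniqueness no later step writes there.
simulation : ∀ (a : Fin q) (loc : Table m l) (ss : List (Instr m q × Fin l)) →
  Unique (map proj₂ ss) → All (Safe loc) ss → ∀ y →
  registers a (finalTable loc ss) (exec (translate a loc ss) y)
    ≡ exec (map proj₁ ss) (registers a loc y)
simulation a loc [] _ _ y = refl
simulation {m = m} a loc (((r , e) , c) ∷ ss) (c∉ ∷ ss!) (safe ∷ safes) y =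
  trans (simulation a _ ss ss! safes′ _)
        (cong (exec (map proj₁ ss)) (registers-write a loc r c _ y safe))
  where
  safes′ : All (Safe (loc [ r ]≔ just c)) ss
  safes′ = All.tabulate λ {s} s∈ j j≢ eq → case s∈ j j≢ eq (j ≟ r)
    where
    case : ∀ {s} → s ∈ ss → ∀ j → j ≢ register s →
      lookup (loc [ r ]≔ just c) j ≡ just (proj₂ s) → Dec (j ≡ r) → ⊥
    case s∈ j j≢ eq (yes refl) = All.lookup c∉ (∈-map⁺ proj₂ s∈)
      (just-injective (trans (sym (lookup∘update r loc (just c))) eq))
    case s∈ j j≢ eq (no j≢r)   = All.lookup safes s∈ j j≢
      (trans (sym (lookup∘update′ j≢r loc (just c))) eq)

-- The two bounds

Sequentializable : F n q → ℕ → Set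
Sequentializable {n} {q} h k = Σ (F (n + k) q) λ f → Σ (List (Fin (n + k))) λ w →
  Π (n + k) w × Sequentializes (m≤m+n n k) f w h

Computes : F n q → n ≤ m → ℕ → Set
Computes {q = q} {m = m} h n≤m t = Σ (Vec (F m q) t) λ gs →
  VAll.All F* gs × (∀ x → pr n≤m (run gs x) ≡ h (pr n≤m x))

-- Lower bound: from programs to sequentializations

assignments⇒sequentializable : ∀ {k} (h : F n q) (is : List (Instr (n + k) q)) →
  Π (n + k) (map proj₁ is) → (∀ x → pr (m≤m+n n k) (exec is x) ≡ h (pr (m≤m+n n k) x)) →
  Sequentializable h k
assignments⇒sequentializable {n = n} {k = k} h is π correct
  with exec⇒updateWord is (Π⇒Unique π)
... | f , f≗ = f , map proj₁ is , π , λ x → trans (cong (pr (m≤m+n n k)) (f≗ x)) (correct x)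

module Compiled (a : Fin q) (h : F n q) (n≤m : n ≤ m) (is : List (Instr m q))
  (correct : ∀ x → pr n≤m (exec is x) ≡ h (pr n≤m x)) where

  -- Correctness holds for all initial contents of the extra registers, so they may all start with
  -- `a`, the value that an empty table entry reads as.
  input : Vec (Fin q) n → Vec (Fin q) m
  input = padRight n≤m a

  output : ∀ z i → lookup (exec is (input z)) (inject≤ i n≤m) ≡ lookup (h z) i
  output z i = begin
    lookup (exec is (input z)) (inject≤ i n≤m)   ≡⟨ lookup-truncate n≤m (exec is (input z)) i ⟨
    lookup (pr n≤m (exec is (input z))) i        ≡⟨ cong (λ x → lookup x i) (correct (input z)) ⟩
    lookup (h (pr n≤m (input z))) i              ≡⟨ cong (λ x → lookup (h x) i) (truncate-padRight n≤m a z) ⟩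
    lookup (h z) i                               ∎
    where open ≡-Reasoning

  unwritten⇒trivial : ∀ i → inject≤ i n≤m ∉ map proj₁ is → Trivial h i
  unwritten⇒trivial i i∉ z = begin
    lookup (h z) i                               ≡⟨ output z i ⟨
    lookup (exec is (input z)) (inject≤ i n≤m)   ≡⟨ exec-∉ is i∉ (input z) ⟩
    lookup (input z) (inject≤ i n≤m)             ≡⟨ lookup-truncate n≤m (input z) i ⟨
    lookup (pr n≤m (input z)) i                  ≡⟨ cong (λ x → lookup x i) (truncate-padRight n≤m a z) ⟩
    lookup z i                                   ∎
    where open ≡-Reasoning

  nontrivials! : Unique (nontrivials h)
  nontrivials! = Unique.filter⁺ _ (Unique.allFin⁺ n)

  written! : Unique (map (λ i → inject≤ i n≤m) (nontrivials h))
  written! = Unique.map⁺ (inject≤-injective n≤m n≤m _ _) nontrivials!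

  written⊆ : map (λ i → inject≤ i n≤m) (nontrivials h) ⊆ map proj₁ is
  written⊆ r∈ with ∈-map⁻ _ r∈
  ... | i , i∈ , refl with inject≤ i n≤m ∈? map proj₁ is
  ...   | yes i∈is = i∈is
  ...   | no i∉is  = contradiction (unwritten⇒trivial i i∉is)
    (proj₂ (∈-filter⁻ (¬? ∘ trivial? h) {xs = List.allFin n} i∈))

  -- A register that is never written keeps its input, so each nontrivial coordinate needs a write
  -- of its own.
  Ω≤length : Ω h ≤ length is
  Ω≤length = begin
    Ω h                                                     ≡⟨ length-nontrivials h ⟨
    length (nontrivials h)                                  ≡⟨ length-map _ (nontrivials h) ⟨
    length (map (λ i → inject≤ i n≤m) (nontrivials h))      ≤⟨ Unique-⊆⇒length≤ written! written⊆ ⟩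
    length (map proj₁ is)                                   ≡⟨ length-map proj₁ is ⟩
    length is                                               ∎
    where open ≤-Reasoning

  -- The writes left over after reserving one for each nontrivial coordinate; by `Ω≤length` the
  -- truncated subtraction is exact.
  k : ℕ
  k = length is ∸ Ω h

  homes : List (Fin m × Fin (n + k))
  homes = map (λ i → inject≤ i n≤m , i ↑ˡ k) (nontrivials h)

  fresh : List (Fin (n + k))
  fresh = List.tabulate (n ↑ʳ_)

  home-registers : map proj₁ homes ≡ map (λ i → inject≤ i n≤m) (nontrivials h)
  home-registers = sym (map-∘ (nontrivials h))

  home-locations : map proj₂ homes ≡ map (_↑ˡ k) (nontrivials h)
  home-locations = sym (map-∘ (nontrivials h))

  lengths : length homes + length fresh ≡ length is
  lengths = begin
    length homes + length fresh   ≡⟨ cong₂ _+_ (trans (length-map _ (nontrivials h)) (length-nontrivials h)) (length-tabulate _) ⟩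
    Ω h + k                       ≡⟨ m+[n∸m]≡n Ω≤length ⟩
    length is                     ∎
    where open ≡-Reasoning

  open Allocation (allocate is homes fresh
    (subst Unique (sym home-registers) written!)
    (subst (_⊆ map proj₁ is) (sym home-registers) written⊆) lengths)

  -- At the start every coordinate below n, trivial or not, is read from the location that carries
  -- its input.
  table : Table m (n + k)
  table = padRight n≤m nothing (Vec.tabulate (just ∘ (_↑ˡ k)))

  registers-table : ∀ y → registers a table y ≡ input (pr (m≤m+n n k) y)
  registers-table y = trans (map-padRight _ n≤m nothing _) (cong input (lookup-ext λ i → begin
    lookup (Vec.map (maybe′ (lookup y) a) (Vec.tabulate (just ∘ (_↑ˡ k)))) i   ≡⟨ lookup-map i _ (Vec.tabulate (just ∘ (_↑ˡ k))) ⟩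
    maybe′ (lookup y) a (lookup (Vec.tabulate (just ∘ (_↑ˡ k))) i)             ≡⟨ cong (maybe′ (lookup y) a) (lookup∘tabulate _ i) ⟩
    lookup y (i ↑ˡ k)                                                          ≡⟨ pr-lookup-↑ˡ n k y i ⟨
    lookup (pr (m≤m+n n k) y) i                                                ∎))
    where open ≡-Reasoning

  table-just : ∀ {r c} → lookup table r ≡ just c → ∃ λ i → r ≡ inject≤ i n≤m × c ≡ i ↑ˡ k
  table-just {r} eq with lookup-padRight-just n≤m _ r eq
  ... | i , r≡ , eq′ = i , r≡ , just-injective (trans (sym eq′) (lookup∘tabulate _ i))

  -- A fresh location occurs nowhere in the initial table, and a home occurs only at the register
  -- whose write is sent there.
  safe : All (Safe table) steps
  safe = All.map (λ {s} → go {s}) sound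
    where
    go : ∀ {s : Instr m q × Fin (n + k)} → proj₂ s ∈ fresh ⊎ (register s , proj₂ s) ∈ homes → Safe table s
    go (inj₁ c∈fresh) r r≢ eq with table-just eq | ∈-tabulate⁻ c∈fresh
    ... | i , _ , refl | j , eq′ = ↑ˡ≢↑ʳ n k i j eq′
    go (inj₂ s∈homes) r r≢ eq with table-just eq | ∈-map⁻ _ s∈homes
    ... | i , refl , refl | j , _ , eq′ with ↑ˡ-injective k i j (cong proj₂ eq′)
    ...   | refl = r≢ (sym (cong proj₁ eq′))

  -- Every coordinate has to occur in the word, hence the identity writes.
  trivials : List (Fin n)
  trivials = filter (trivial? h) (List.allFin n)

  keep : Fin n → Instr (n + k) q
  keep i = i ↑ˡ k , λ y → lookup y (i ↑ˡ k)

  exec-keep : ∀ js y → exec (map keep js) y ≡ y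
  exec-keep []       y = refl
  exec-keep (j ∷ js) y = trans (cong (exec (map keep js)) ([]≔-lookup y (j ↑ˡ k))) (exec-keep js y)

  single : List (Instr (n + k) q)
  single = translate a table steps ++ map keep trivials

  -- The locations fall into three blocks: trivial coordinates, covered by `keep`, and the homes and
  -- fresh locations, covered by the translated program.
  single-targets : Π (n + k) (map proj₁ single)
  single-targets = begin
    map proj₁ single
      ≡⟨ map-++ proj₁ (translate a table steps) (map keep trivials) ⟩
    map proj₁ (translate a table steps) ++ map proj₁ (map keep trivials)
      ≡⟨ cong₂ _++_ (translate-targets a table steps) (sym (map-∘ trivials)) ⟩
    map proj₂ steps ++ map (_↑ˡ k) trivials
      ↭⟨ ↭.++-comm (map proj₂ steps) _ ⟩
    map (_↑ˡ k) trivials ++ map proj₂ steps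
      ↭⟨ ↭.++⁺ˡ (map (_↑ˡ k) trivials) targets ⟩
    map (_↑ˡ k) trivials ++ map proj₂ homes ++ fresh
      ≡⟨ cong (λ cs → map (_↑ˡ k) trivials ++ cs ++ fresh) home-locations ⟩
    map (_↑ˡ k) trivials ++ map (_↑ˡ k) (nontrivials h) ++ fresh
      ≡⟨ ++-assoc (map (_↑ˡ k) trivials) _ fresh ⟨
    (map (_↑ˡ k) trivials ++ map (_↑ˡ k) (nontrivials h)) ++ fresh
      ≡⟨ cong (_++ fresh) (map-++ (_↑ˡ k) trivials (nontrivials h)) ⟨
    map (_↑ˡ k) (trivials ++ nontrivials h) ++ fresh
      ↭⟨ ↭.++⁺ʳ fresh (↭.map⁺ (_↑ˡ k) (filter-∁-↭ (trivial? h) (List.allFin n))) ⟩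
    map (_↑ˡ k) (List.allFin n) ++ fresh
      ≡⟨ allFin-+ n k ⟨
    List.allFin (n + k) ∎
    where open PermutationReasoning

  targets! : Unique (map proj₂ steps)
  targets! = Unique-resp-↭ (↭-sym targets)
    (subst (λ cs → Unique (cs ++ fresh)) (sym home-locations)
      (Unique.++⁺ (Unique.map⁺ (↑ˡ-injective k _ _) nontrivials!)
                  (Unique.tabulate⁺ (↑ʳ-injective n _ _))
                  λ (c∈₁ , c∈₂) → disjoint (∈-map⁻ _ c∈₁) (∈-tabulate⁻ c∈₂)))
    where
    disjoint : ∀ {c} → (∃ λ i → i ∈ nontrivials h × c ≡ i ↑ˡ k) → (∃ λ j → c ≡ n ↑ʳ j) → ⊥
    disjoint (i , _ , refl) (j , eq) = ↑ˡ≢↑ʳ n k i j eq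

  trivial-∉ : ∀ {i} → Trivial h i → i ↑ˡ k ∉ map proj₁ (translate a table steps)
  trivial-∉ {i} triv i∈
    with ∈-++⁻ (map (_↑ˡ k) (nontrivials h)) (subst (λ cs → i ↑ˡ k ∈ cs ++ fresh) home-locations
           (↭.∈-resp-↭ targets (subst (i ↑ˡ k ∈_) (translate-targets a table steps) i∈)))
  ... | inj₂ i∈fresh with j , eq ← ∈-tabulate⁻ i∈fresh = ↑ˡ≢↑ʳ n k i j eq
  ... | inj₁ i∈homes with ∈-map⁻ _ i∈homes
  ...   | j , j∈ , eq with ↑ˡ-injective k i j eq
  ...     | refl = proj₂ (∈-filter⁻ (¬? ∘ trivial? h) {xs = List.allFin n} j∈) triv

  translate-correct : ∀ y i →
    lookup (exec (translate a table steps) y) (i ↑ˡ k) ≡ lookup (h (pr (m≤m+n n k) y)) i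
  translate-correct y i with trivial? h i
  -- The original program may write register i, but such writes go to fresh locations. Location i
  -- thus retains the input, which is the required output.
  ... | yes triv = begin
    lookup (exec (translate a table steps) y) (i ↑ˡ k)   ≡⟨ exec-∉ (translate a table steps) (trivial-∉ triv) y ⟩
    lookup y (i ↑ˡ k)                                    ≡⟨ pr-lookup-↑ˡ n k y i ⟨
    lookup (pr (m≤m+n n k) y) i                          ≡⟨ triv _ ⟨
    lookup (h (pr (m≤m+n n k) y)) i                      ∎
    where open ≡-Reasoning
  -- The last write to register i went to its home, so the final table reads register i from
  -- location i, and the simulation transports the original output there.
  ... | no ¬triv = begin
    lookup y′ (i ↑ˡ k)
      ≡⟨ cong (maybe′ (lookup y′) a) (finalTable-last table (last home∈)) ⟨
    maybe′ (lookup y′) a (lookup (finalTable table steps) (inject≤ i n≤m))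
      ≡⟨ lookup-map (inject≤ i n≤m) _ (finalTable table steps) ⟨
    lookup (registers a (finalTable table steps) y′) (inject≤ i n≤m)
      ≡⟨ cong (λ x → lookup x (inject≤ i n≤m)) (simulation a table steps targets! safe y) ⟩
    lookup (exec (map proj₁ steps) (registers a table y)) (inject≤ i n≤m)
      ≡⟨ cong₂ (λ js x → lookup (exec js x) (inject≤ i n≤m)) program (registers-table y) ⟩
    lookup (exec is (input (pr (m≤m+n n k) y))) (inject≤ i n≤m)
      ≡⟨ output _ i ⟩
    lookup (h (pr (m≤m+n n k) y)) i ∎
    where
    open ≡-Reasoning
    y′ = exec (translate a table steps) y
    home∈ : (inject≤ i n≤m , i ↑ˡ k) ∈ homes
    home∈ = ∈-map⁺ _ (∈-filter⁺ (¬? ∘ trivial? h) (∈-allFin i) ¬triv)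

  single-correct : ∀ y → pr (m≤m+n n k) (exec single y) ≡ h (pr (m≤m+n n k) y)
  single-correct y = trans
    (cong (pr (m≤m+n n k)) (trans (exec-++ (translate a table steps) _ y) (exec-keep trivials _)))
    (lookup-ext λ i → trans (pr-lookup-↑ˡ n k _ i) (translate-correct y i))

  sequentializable : Sequentializable h k
  sequentializable = assignments⇒sequentializable h single single-targets single-correct

-- Compilation yields a sequentialization whose number of extra coordinates is the program length
-- minus `Ω h`; minimality of k bounds that number from below. The symbol `a` serves as padding.
lower-bound : ∀ {k} → Fin q → (h : F n q) → (∀ j → Sequentializable h j → k ≤ j) →
  (n≤m : n ≤ m) → Computes h n≤m t → Ω h + k ≤ t
lower-bound {t = t} {k = k} a h k-least n≤m (gs , g*s , correct) = begin
  Ω h + k     ≤⟨ +-monoʳ-≤ (Ω h) (k-least C.k C.sequentializable) ⟩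
  Ω h + C.k   ≡⟨ m+[n∸m]≡n C.Ω≤length ⟩
  length is   ≡⟨ length-instrs g*s ⟩
  t           ∎
  where
  open ≤-Reasoning
  is = instrs g*s
  module C = Compiled a h n≤m is
    (λ x → trans (cong (pr n≤m) (exec-instrs g*s x)) (correct x))

-- Upper bound: dropping the updates of trivial coordinates

updateWord-∉ : (f : F m q) {w : List (Fin m)} {c : Fin m} → c ∉ w →
  ∀ x → lookup (updateWord f w x) c ≡ lookup x c
updateWord-∉ f {[]}    c∉ x = refl
updateWord-∉ f {d ∷ w} c∉ x = trans (updateWord-∉ f (c∉ ∘ there) _) (lookup∘update′ (c∉ ∘ here) x _)

-- Comparing the first and last states suffices: a coordinate occurs once in `w`, so if its value is
-- the same at both ends, its only update changed nothing.
updateWord-filter : ∀ {p} {P : Pred (Fin m) p} (P? : Decidable P) (f : F m q) {w : List (Fin m)} →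
  Unique w → ∀ x → (∀ {c} → c ∈ w → ¬ P c → lookup (updateWord f w x) c ≡ lookup x c) →
  updateWord f (filter P? w) x ≡ updateWord f w x
updateWord-filter P? f {[]}    _ x _ = refl
updateWord-filter P? f {c ∷ w} (c∉ ∷ w!) x fixed = go (P? c)
  where
  open ≡-Reasoning
  x′ = update f c x

  -- The first update touches only c, so at the remaining letters `x′` agrees with `x`.
  tail : updateWord f (filter P? w) x′ ≡ updateWord f w x′
  tail = updateWord-filter P? f w! x′ λ d∈ ¬Pd →
    trans (fixed (there d∈) ¬Pd) (sym (lookup∘update′ (All.lookup c∉ d∈ ∘ sym) x _))

  go : Dec _ → updateWord f (filter P? (c ∷ w)) x ≡ updateWord f w x′
  go (yes Pc) = trans (cong (λ v → updateWord f v x) (filter-accept P? Pc)) tail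
  go (no ¬Pc) = begin
    updateWord f (filter P? (c ∷ w)) x   ≡⟨ cong (λ v → updateWord f v x) (filter-reject P? ¬Pc) ⟩
    updateWord f (filter P? w) x         ≡⟨ cong (updateWord f (filter P? w)) x′≡x ⟨
    updateWord f (filter P? w) x′        ≡⟨ tail ⟩
    updateWord f w x′                    ∎
    where
    -- c is not written again, so the value it receives now is its final value.
    x′≡x : x′ ≡ x
    x′≡x = begin
      x [ c ]≔ lookup (f x) c                 ≡⟨ cong (x [ c ]≔_) (lookup∘update c x _) ⟨
      x [ c ]≔ lookup x′ c                    ≡⟨ cong (x [ c ]≔_) (updateWord-∉ f (Unique.Unique[x∷xs]⇒x∉xs (c∉ ∷ w!)) x′) ⟨
      x [ c ]≔ lookup (updateWord f w x′) c   ≡⟨ cong (x [ c ]≔_) (fixed (here refl) ¬Pc) ⟩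
      x [ c ]≔ lookup x c                     ≡⟨ []≔-lookup x c ⟩
      x                                       ∎

updates-F* : (f : F m q) (w : List (Fin m)) → VAll.All F* (Vec.map (update f) (fromList w))
updates-F* f []      = VAll.[]
updates-F* f (c ∷ w) = (c , λ j j≢c x → lookup∘update′ j≢c x _) VAll.∷ updates-F* f w

run-updates : (f : F m q) (w : List (Fin m)) → ∀ x →
  run (Vec.map (update f) (fromList w)) x ≡ updateWord f w x
run-updates f []      x = refl
run-updates f (c ∷ w) x = run-updates f w _

upper-bound : ∀ {k} (h : F n q) → Sequentializable h k → Computes h (m≤m+n n k) (Ω h + k)
upper-bound {n = n} {k = k} h (f , w , π , correct) =
  subst (Computes h (m≤m+n n k)) length-kept
    ( Vec.map (update f) (fromList (filter kept? w))
    , updates-F* f (filter kept? w)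
    , λ x → trans (cong (pr (m≤m+n n k)) (trans (run-updates f (filter kept? w) x) (drop x))) (correct x))
  where
  open ≡-Reasoning

  -- Defined on the two summands so that the blocks of `allFin-+` can be counted separately: `Ω h`
  -- letters survive in the first and all k in the second.
  Kept′ : Fin n ⊎ Fin k → Set
  Kept′ = [ ¬_ ∘ Trivial h , (λ _ → ⊤) ]′

  kept′? : Decidable Kept′
  kept′? (inj₁ i) = ¬? (trivial? h i)
  kept′? (inj₂ _) = yes tt

  kept? : Decidable (Kept′ ∘ splitAt n)
  kept? = kept′? ∘ splitAt n

  length-kept : length (filter kept? w) ≡ Ω h + k
  length-kept = begin
    length (filter kept? w)
      ≡⟨ ↭.↭-length (↭.filter-↭ kept? π) ⟩
    length (filter kept? (List.allFin (n + k)))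
      ≡⟨ cong (length ∘ filter kept?) (allFin-+ n k) ⟩
    length (filter kept? (map (_↑ˡ k) (List.allFin n) ++ List.tabulate (n ↑ʳ_)))
      ≡⟨ cong length (filter-++ kept? (map (_↑ˡ k) (List.allFin n)) _) ⟩
    length (filter kept? (map (_↑ˡ k) (List.allFin n)) ++ filter kept? (List.tabulate (n ↑ʳ_)))
      ≡⟨ length-++ (filter kept? (map (_↑ˡ k) (List.allFin n))) ⟩
    length (filter kept? (map (_↑ˡ k) (List.allFin n))) + length (filter kept? (List.tabulate (n ↑ʳ_)))
      ≡⟨ cong₂ _+_
           (length-filter-map kept? (¬? ∘ trivial? h) (_↑ˡ k)
             (λ i → cong (does ∘ kept′?) (splitAt-↑ˡ n i k)) (List.allFin n))
           (cong length (filter-all kept?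
             (All.tabulate⁺ λ j → subst Kept′ (sym (splitAt-↑ʳ n k j)) tt))) ⟩
    length (nontrivials h) + length (List.tabulate {n = k} (n ↑ʳ_))
      ≡⟨ cong₂ _+_ (length-nontrivials h) (length-tabulate (n ↑ʳ_)) ⟩
    Ω h + k ∎

  fixed : ∀ x i → Trivial h i → lookup (updateWord f w x) (i ↑ˡ k) ≡ lookup x (i ↑ˡ k)
  fixed x i triv = begin
    lookup (updateWord f w x) (i ↑ˡ k)             ≡⟨ pr-lookup-↑ˡ n k _ i ⟨
    lookup (pr (m≤m+n n k) (updateWord f w x)) i   ≡⟨ cong (λ y → lookup y i) (correct x) ⟩
    lookup (h (pr (m≤m+n n k) x)) i                ≡⟨ triv _ ⟩
    lookup (pr (m≤m+n n k) x) i                    ≡⟨ pr-lookup-↑ˡ n k x i ⟩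
    lookup x (i ↑ˡ k)                              ∎

  drop : ∀ x → updateWord f (filter kept? w) x ≡ updateWord f w x
  drop x = updateWord-filter kept? f (Π⇒Unique π) x λ {c} _ ¬kept → go c ¬kept (splitAt n c) refl
    where
    go : ∀ c → ¬ Kept′ (splitAt n c) → ∀ s → splitAt n c ≡ s → lookup (updateWord f w x) c ≡ lookup x c
    go c ¬kept (inj₂ j) eq = contradiction (subst Kept′ (sym eq) tt) ¬kept
    go c ¬kept (inj₁ i) eq with trivial? h i
    ... | no ¬triv = contradiction (subst Kept′ (sym eq) ¬triv) ¬kept
    ... | yes triv with refl ← splitAt⁻¹-↑ˡ {n} {k} {c} eq = fixed x i triv

mainTheorem7 : ∀ (q n : ℕ) → 2 ≤ q → 1 ≤ n → (h : F n q) (k : ℕ) → κmin≡ h k →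
    𝓛*≡ h (Ω h + k) × 𝓛≡ h (m≤m+n n k) (Ω h + k)
-- Matching q as a successor provides `zero` as the padding symbol.
mainTheorem7 (suc _) n _ _ h k (seq , k-least) =
  -- The minimum over all m is attained at n + k, since `lower` holds for every m.
  ((n + k , m≤m+n n k , exact) , λ _ (_ , n≤m , program , _) → lower n≤m program) , exact
  where
  lower : ∀ {m t} (n≤m : n ≤ m) → Computes h n≤m t → Ω h + k ≤ t
  lower = lower-bound zero h k-least
  exact : 𝓛≡ h (m≤m+n n k) (Ω h + k)
  exact = upper-bound h seq , λ _ → lower (m≤m+n n k)
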